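{- Let $n$ and $D$ be positive integers such that $D\le n/2$. If an algorithm $A$ solves treasure hunting in $O(D)$ rounds whenever the treasure is at distance $D$ from the initial position of the agent, then there exists an $n$-node graph $G$ with the treasure at distance $D$ from the initial position of the agent such that $A$ requires $\Omega(D\log(n/D))$ bits of advice.
   Context: Treasure hunt: a single mobile agent starts at a node of an undirected connected graph whose nodes are unlabeled; at each node $v$ of degree $d$ the incident edges carry distinct port numbers $0,\dots,d-1$ (local numbering). The agent moves in synchronous rounds, in each round either staying or taking a chosen port to an adjacent node; on entering a node it learns the node's degree and the port by which it entered. It cannot mark nodes. It must reach a stationary target (the treasure) at an unknown node and recognizes it upon arrival. The agent runs a deterministic algorithm that receives an advice binary string from an oracle knowing the whole instance (graph with port numbering, initial position, treasure location); the size of advice is the length of this string. The running time is the number of rounds until the agent reaches the treasure. -}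

module Defs where

open import Data.Nat using (ℕ; zero; suc; _+_; _*_; _≤_; _<_; _<ᵇ_)
open import Data.Fin using (Fin)
open import Data.List using (List; []; _∷_; length)
open import Data.Maybe using (Maybe; just; nothing)
open import Data.Bool using (Bool; if_then_else_)
open import Data.Product using (Σ; ∃; _×_; _,_; proj₁)
open import Data.Unit using (⊤)
open import Relation.Binary.PropositionalEquality using (_≡_; _≢_)
open import Relation.Nullary using (¬_)

-- A simple undirected graph on the node set Fin n with a local port numbering.
-- At node v the ports are 0 .. deg v - 1; taking port p (p < deg v) from v leads
-- to nbr v p, entering it by port entry v p.  Values of nbr/entry at p ≥ deg v
-- are meaningless.
record PortGraph (n : ℕ) : Set where
  field
    deg   : Fin n → ℕ
    nbr   : Fin n → ℕ → Fin n
    entry : Fin n → ℕ → ℕ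
    entry-valid : ∀ v p → p < deg v → entry v p < deg (nbr v p)
    back-nbr    : ∀ v p → p < deg v → nbr (nbr v p) (entry v p) ≡ v
    back-entry  : ∀ v p → p < deg v → entry (nbr v p) (entry v p) ≡ p
    loopless    : ∀ v p → p < deg v → nbr v p ≢ v
    simple      : ∀ v p q → p < deg v → q < deg v → nbr v p ≡ nbr v q → p ≡ q

open PortGraph public

module _ {n : ℕ} (G : PortGraph n) where

  follow : Fin n → List ℕ → Fin n
  follow v []       = v
  follow v (p ∷ ps) = follow (nbr G v p) ps

  ValidWalk : Fin n → List ℕ → Set
  ValidWalk v []       = ⊤
  ValidWalk v (p ∷ ps) = (p < deg G v) × ValidWalk (nbr G v p) ps

  Reach : Fin n → Fin n → ℕ → Set
  Reach u w m = Σ (List ℕ) λ ps → length ps ≡ m × ValidWalk u ps × follow u ps ≡ w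

  Dist : Fin n → Fin n → ℕ → Set
  Dist u w m = Reach u w m × (∀ k → k < m → ¬ Reach u w k)

  Connected : Set
  Connected = ∀ u w → ∃ λ m → Reach u w m

record Instance (n : ℕ) : Set where
  field
    graph     : PortGraph n
    connected : Connected graph
    start     : Fin n
    treasure  : Fin n

open Instance public

-- What the agent perceives after a round: nothing = it stayed;
-- just (d , q) = it entered a node of degree d by port q.
Obs : Set
Obs = Maybe (ℕ × ℕ)

-- Action in a round: nothing = stay; just p = take port p.
Action : Set
Action = Maybe ℕ

-- A deterministic algorithm: given the advice string, the degree of the
-- initial node and the history of observations (most recent first),
-- it chooses the next action.
Algorithm : Set
Algorithm = List Bool → ℕ → List Obs → Action

Oracle : Set
Oracle = (n : ℕ) → Instance n → List Bool

-- One round.  Taking a non-existent port (p ≥ degree) is treated as staying.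
step : {n : ℕ} → PortGraph n → Fin n → Action → Fin n × Obs
step G v nothing  = v , nothing
step G v (just p) =
  if p <ᵇ deg G v
  then (nbr G v p , just (deg G (nbr G v p) , entry G v p))
  else (v , nothing)

run : {n : ℕ} → PortGraph n → Algorithm → List Bool → Fin n → ℕ → Fin n × List Obs
run G A adv s zero    = s , []
run G A adv s (suc t) with run G A adv s t
... | v , h with step G v (A adv (deg G s) h)
...   | v' , o = v' , o ∷ h

position : {n : ℕ} → PortGraph n → Algorithm → List Bool → Fin n → ℕ → Fin n
position G A adv s t = proj₁ (run G A adv s t)

ReachesWithin : Algorithm → List Bool → {n : ℕ} → Instance n → ℕ → Set
ReachesWithin A adv I T =
  ∃ λ t → t ≤ T × position (graph I) A adv (start I) t ≡ treasure I

SolvesInLinearTime : Algorithm → Oracle → ℕ → Set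
SolvesInLinearTime A O c =
  ∀ (n : ℕ) (I : Instance n) (D : ℕ) →
  Dist (graph I) (start I) (treasure I) D →
  ReachesWithin A (O n I) I (c * D)

{-# OPTIONS --safe #-}
module Submission where

-- A gadget consists of a root, s left and s right nodes; the root is joined to all left nodes, and the
-- left and right nodes form a complete bipartite graph in which one hidden edge is subdivided by the
-- root of the next gadget.  The hidden edge is one of s² candidates that look alike until traversed,
-- and the next root is always at distance 2.  Chain m gadgets and append a path to fix the number of
-- nodes and the distance.  For given advice, the run reveals the hidden edges one by one, so the
-- instance is determined by the set of at most m rounds, out of T, in which a hidden edge is found.
-- There are at most (4R)ᵐ such sets when T = Rm, against s²ᵐ instances; taking m proportional to D
-- and s proportional to n / D, with constants depending on the running time, makes s² exceed
-- 4R (n / D), and pigeonhole forces advice of length m log (n / D).  Having quadratically many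
-- candidates per gadget is what keeps the bound alive when n / D is bounded.
-- For D = 1 no gadget fits, and the treasure is hidden at one of the neighbours of the first root.

open import Defs
open import Data.Bool using (Bool; true; false; T)
open import Data.Empty using (⊥)
open import Data.Fin as Fin using (Fin; zero; suc; toℕ; fromℕ<; _↑ˡ_; _↑ʳ_; splitAt; punchIn; remQuot; combine)
open import Data.Fin.Properties using (_≟_; any?; pigeonhole; <⇒≢; toℕ<n; toℕ-fromℕ<; fromℕ<-toℕ; punchInᵢ≢i; +↔⊎; splitAt-↑ˡ; splitAt-↑ʳ; splitAt⁻¹-↑ˡ; splitAt⁻¹-↑ʳ; combine-remQuot; combine-injective)
open import Data.List using (List; []; _∷_; length; lookup; map; upTo; _++_)
open import Data.List.Membership.Propositional using (_∈_)
open import Data.List.Membership.Propositional.Properties using (∈-map⁺; ∈-++⁺ˡ; ∈-++⁺ʳ; ∈-upTo⁺)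
open import Data.List.Properties using (∷-injectiveˡ; ∷-injectiveʳ; length-map; length-++; length-upTo)
open import Data.List.Relation.Unary.Any using (here; there; index)
open import Data.List.Relation.Unary.Any.Properties using (lookup-index)
open import Data.Maybe using (Maybe; just; nothing)
open import Data.Nat hiding (_≟_)
open import Data.Nat.DivMod
open import Data.Nat.Logarithm using (⌊log₂_⌋; ⌊log₂⌋-mono-≤; ⌊log₂⌊n/2⌋⌋≡⌊log₂n⌋∸1; ⌊log₂[2^n]⌋≡n)
open import Data.Nat.Properties hiding (_≟_; <⇒≢)
open import Data.Nat.Tactic.RingSolver using (solve-∀)
open import Data.Product using (Σ; ∃; ∃₂; _×_; _,_; proj₁; proj₂)
open import Data.Product.Properties using (≡-dec)
open import Data.Sum using (_⊎_; inj₁; inj₂)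
open import Data.Unit using (⊤; tt)
open import Data.Vec using (Vec; []; _∷_)
open import Data.Vec.Properties using (∷-injective)
open import Function using (_∘_; _↔_; Inverse)
open import Function.Properties.Inverse using (↔-refl; ↔-sym)
open import Relation.Binary.PropositionalEquality
open import Relation.Nullary using (Dec; yes; no; ¬_; contradiction; does)

-- Counting Boolean words with few ones

bump : Bool → ℕ → ℕ
bump true  k = suc k
bump false k = k

ones : List Bool → ℕ
ones []       = 0
ones (b ∷ bs) = bump b (ones bs)

bump-suc : ∀ b k → bump b (suc k) ≡ suc (bump b k)
bump-suc true  k = refl
bump-suc false k = refl

^-distribʳ-* : ∀ k m n → (m * n) ^ k ≡ m ^ k * n ^ k
^-distribʳ-* zero    m n = refl
^-distribʳ-* (suc k) m n =
  trans (cong (m * n *_) (^-distribʳ-* k m n)) ([m*n]*[o*p]≡[m*o]*[n*p] m n (m ^ k) (n ^ k))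

words : ℕ → ℕ → List (List Bool)
words zero    m       = [] ∷ []
words (suc T) zero    = map (false ∷_) (words T zero)
words (suc T) (suc m) = map (false ∷_) (words T (suc m)) ++ map (true ∷_) (words T m)

∈-words : ∀ bs {m} → ones bs ≤ m → bs ∈ words (length bs) m
∈-words []                   _         = here refl
∈-words (false ∷ bs) {zero}  ≤m        = ∈-map⁺ (false ∷_) (∈-words bs ≤m)
∈-words (false ∷ bs) {suc m} ≤m        = ∈-++⁺ˡ (∈-map⁺ (false ∷_) (∈-words bs ≤m))
∈-words (true ∷ bs)  {suc m} (s≤s ≤m)  =
  ∈-++⁺ʳ (map (false ∷_) (words (length bs) (suc m))) (∈-map⁺ (true ∷_) (∈-words bs ≤m))

-- Chernoff-style count with x = 1/R, cleared of denominators. Weighted by x to the number of ones,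
-- all words of length T together weigh (1 + x)ᵀ, and each word counted here weighs at least xᵐ. The
-- induction follows Pascal's rule, with Rᵐ⁺¹ + Rᵐ = Rᵐ (R + 1) joining the two summands.
length-words : ∀ R .{{_ : NonZero R}} T m → length (words T m) * R ^ T ≤ R ^ m * suc R ^ T
length-words R zero m = *-monoˡ-≤ 1 (m^n>0 R m)
length-words R (suc T) zero = begin
  length (map (false ∷_) (words T zero)) * (R * R ^ T)  ≡⟨ cong (_* (R * R ^ T)) (length-map _ (words T zero)) ⟩
  length (words T zero) * (R * R ^ T)                   ≡⟨ lemma (length (words T zero)) R (R ^ T) ⟩
  R * (length (words T zero) * R ^ T)                   ≤⟨ *-mono-≤ (n≤1+n R) (length-words R T zero) ⟩
  suc R * (1 * suc R ^ T)                               ≡⟨ lemma (suc R) 1 (suc R ^ T) ⟩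
  1 * (suc R * suc R ^ T)                               ∎
  where
  open ≤-Reasoning
  lemma : ∀ a b c → a * (b * c) ≡ b * (a * c)
  lemma = solve-∀
length-words R (suc T) (suc m) = begin
  length (map (false ∷_) W₁ ++ map (true ∷_) W₀) * (R * R ^ T)
    ≡⟨ cong (_* (R * R ^ T)) (trans (length-++ (map (false ∷_) W₁)) (cong₂ _+_ (length-map _ W₁) (length-map _ W₀))) ⟩
  (length W₁ + length W₀) * (R * R ^ T)
    ≡⟨ left (length W₁) (length W₀) R (R ^ T) ⟩
  R * (length W₁ * R ^ T + length W₀ * R ^ T)
    ≤⟨ *-monoʳ-≤ R (+-mono-≤ (length-words R T (suc m)) (length-words R T m)) ⟩
  R * (R * R ^ m * suc R ^ T + R ^ m * suc R ^ T)
    ≡⟨ right R (R ^ m) (suc R ^ T) ⟩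
  R * R ^ m * (suc R * suc R ^ T) ∎
  where
  open ≤-Reasoning
  W₁ = words T (suc m)
  W₀ = words T m
  left : ∀ a b r t → (a + b) * (r * t) ≡ r * (a * t + b * t)
  left = solve-∀
  right : ∀ r p q → r * (r * p * q + p * q) ≡ r * p * (suc r * q)
  right = solve-∀

-- (1 + 1/R)ᵏ ≤ 1 / (1 − k/R), cleared of denominators.
suc-^-≤ : ∀ R k → (R ∸ k) * suc R ^ k ≤ R * R ^ k
suc-^-≤ R zero    = ≤-refl
suc-^-≤ R (suc k) = begin
  (R ∸ suc k) * (suc R * suc R ^ k)   ≡⟨ *-assoc (R ∸ suc k) (suc R) _ ⟨
  (R ∸ suc k) * suc R * suc R ^ k     ≤⟨ *-monoˡ-≤ (suc R ^ k) (shrink R k) ⟩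
  R * (R ∸ k) * suc R ^ k             ≡⟨ *-assoc R (R ∸ k) _ ⟩
  R * ((R ∸ k) * suc R ^ k)           ≤⟨ *-monoʳ-≤ R (suc-^-≤ R k) ⟩
  R * (R * R ^ k)                     ∎
  where
  open ≤-Reasoning
  shrink : ∀ R k → (R ∸ suc k) * suc R ≤ R * (R ∸ k)
  shrink R k with suc k ≤? R
  ... | no ≰ rewrite m≤n⇒m∸n≡0 (<⇒≤ (≰⇒> ≰)) = z≤n
  ... | yes k<R with d , refl ← m≤n⇒∃[o]m+o≡n k<R
        rewrite m+n∸m≡n k d | +-comm k d | m+n∸n≡m (suc d) k = ≤-trans (m≤m+n _ (k + 1)) (≤-reflexive (lemma d k))
    where
    lemma : ∀ d k → d * suc (suc (d + k)) + (k + 1) ≡ suc (d + k) * suc d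
    lemma = solve-∀

-- Apply `length-words` with 2R for R. By `suc-^-≤`, (1 + 1/(2R))ᴿ ≤ 1 / (1 - 1/2) = 2, so each of
-- the m blocks of R letters costs a factor 2, and each of the m possible ones a factor 2R.
length-words-≤ : ∀ R .{{_ : NonZero R}} m → length (words (R * m) m) ≤ (4 * R) ^ m
length-words-≤ R m = *-cancelʳ-≤ _ _ (S ^ (R * m)) {{m^n≢0 S (R * m)}} (begin
  length (words (R * m) m) * S ^ (R * m)  ≤⟨ length-words S (R * m) m ⟩
  S ^ m * suc S ^ (R * m)                 ≡⟨ cong (S ^ m *_) (^-*-assoc (suc S) R m) ⟨
  S ^ m * (suc S ^ R) ^ m                 ≤⟨ *-monoʳ-≤ (S ^ m) (^-monoˡ-≤ m half) ⟩
  S ^ m * (2 * S ^ R) ^ m                 ≡⟨ cong (S ^ m *_) (^-distribʳ-* m 2 (S ^ R)) ⟩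
  S ^ m * (2 ^ m * (S ^ R) ^ m)           ≡⟨ *-assoc (S ^ m) _ _ ⟨
  S ^ m * 2 ^ m * (S ^ R) ^ m             ≡⟨ cong₂ _*_ (^-distribʳ-* m S 2) (sym (^-*-assoc S R m)) ⟨
  (S * 2) ^ m * S ^ (R * m)               ≡⟨ cong (λ z → z ^ m * S ^ (R * m)) (four R) ⟩
  (4 * R) ^ m * S ^ (R * m)               ∎)
  where
  open ≤-Reasoning
  S = 2 * R
  instance
    S≢0 : NonZero (2 * R)
    S≢0 = m*n≢0 2 R
  four : ∀ R → 2 * R * 2 ≡ 4 * R
  four = solve-∀
  twice : ∀ R → 2 * R ≡ R + R
  twice = solve-∀
  half : suc S ^ R ≤ 2 * S ^ R
  half = *-cancelˡ-≤ R (begin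
    R * suc S ^ R        ≡⟨ cong (_* suc S ^ R) (trans (cong (_∸ R) (twice R)) (m+n∸n≡m R R)) ⟨
    (S ∸ R) * suc S ^ R  ≤⟨ suc-^-≤ S R ⟩
    2 * R * S ^ R        ≡⟨ shuffle R (S ^ R) ⟩
    R * (2 * S ^ R)      ∎)
    where
    shuffle : ∀ a b → 2 * a * b ≡ a * (2 * b)
    shuffle = solve-∀

-- Pigeonhole on short advice strings

shorterThan : ℕ → List (List Bool)
shorterThan zero    = []
shorterThan (suc L) = [] ∷ map (false ∷_) (shorterThan L) ++ map (true ∷_) (shorterThan L)

∈-shorterThan : ∀ bs {L} → length bs < L → bs ∈ shorterThan L
∈-shorterThan []           {suc L} _       = here refl
∈-shorterThan (false ∷ bs) {suc L} (s≤s <L) = there (∈-++⁺ˡ (∈-map⁺ (false ∷_) (∈-shorterThan bs <L)))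
∈-shorterThan (true ∷ bs)  {suc L} (s≤s <L) =
  there (∈-++⁺ʳ (map (false ∷_) (shorterThan L)) (∈-map⁺ (true ∷_) (∈-shorterThan bs <L)))

length-shorterThan : ∀ L → length (shorterThan L) < 2 ^ L
length-shorterThan zero    = s≤s z≤n
length-shorterThan (suc L) = begin-strict
  suc (length (map (false ∷_) S ++ map (true ∷_) S))
    ≡⟨ cong suc (trans (length-++ (map (false ∷_) S)) (cong₂ _+_ (length-map _ S) (length-map _ S))) ⟩
  suc (length S) + length S  <⟨ +-mono-≤-< (length-shorterThan L) (length-shorterThan L) ⟩
  2 ^ L + 2 ^ L              ≡⟨ cong (2 ^ L +_) (+-identityʳ (2 ^ L)) ⟨
  2 ^ suc L                  ∎
  where
  open ≤-Reasoning
  S = shorterThan L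

index-injective : ∀ {A : Set} {xs : List A} {a b} (p : a ∈ xs) (q : b ∈ xs) → index p ≡ index q → a ≡ b
index-injective {xs = xs} p q e = trans (lookup-index p) (trans (cong (lookup xs) e) (sym (lookup-index q)))

-- If all advice were shorter than L, there would be fewer pairs of hint and advice than indices,
-- and two indices would share a pair although the pair determines the index. The hint is whatever
-- else about the run pins down the instance: the rounds of discovery in a chain, the finishing time
-- when D = 1.
long-advice : ∀ {M L} {H : Set} (advice : Fin M → List Bool) (hints : List H) (hint : Fin M → H) →
  (∀ i → hint i ∈ hints) →
  (∀ i j → advice i ≡ advice j → hint i ≡ hint j → i ≡ j) →
  length hints * 2 ^ L < M →
  ∃ λ i → L ≤ length (advice i)
long-advice {M} {L} advice hints hint hint∈ inj few with any? (λ i → L ≤? length (advice i))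
... | yes found = found
... | no none = contradiction (inj i j advice≡ hint≡) (<⇒≢ i<j)
  where
  advice∈ : ∀ i → advice i ∈ shorterThan L
  advice∈ i = ∈-shorterThan (advice i) (≰⇒> (λ L≤ → none (i , L≤)))
  code : Fin M → Fin (length hints * length (shorterThan L))
  code i = combine (index (hint∈ i)) (index (advice∈ i))
  collision : ∃₂ λ i j → i Fin.< j × code i ≡ code j
  collision = pigeonhole (≤-<-trans (*-monoʳ-≤ (length hints) (<⇒≤ (length-shorterThan L))) few) code
  i j : Fin M
  i = proj₁ collision
  j = proj₁ (proj₂ collision)
  i<j : i Fin.< j
  i<j = proj₁ (proj₂ (proj₂ collision))
  indices≡ : index (hint∈ i) ≡ index (hint∈ j) × index (advice∈ i) ≡ index (advice∈ j)
  indices≡ = combine-injective _ _ _ _ (proj₂ (proj₂ (proj₂ collision)))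
  hint≡ : hint i ≡ hint j
  hint≡ = index-injective (hint∈ i) (hint∈ j) (proj₁ indices≡)
  advice≡ : advice i ≡ advice j
  advice≡ = index-injective (advice∈ i) (advice∈ j) (proj₂ indices≡)

-- Numbering the tuples of hidden edges

remQuot-injective : ∀ {m} n (i j : Fin (m * n)) → remQuot {m} n i ≡ remQuot {m} n j → i ≡ j
remQuot-injective {m} n i j e =
  trans (sym (combine-remQuot {m} n i)) (trans (cong (λ p → combine (proj₁ p) (proj₂ p)) e) (combine-remQuot {m} n j))

toVec : ∀ q m → Fin ((q * q) ^ m) → Vec (Fin q × Fin q) m
toVec q zero    i = []
toVec q (suc m) i = remQuot {q} q (proj₁ (remQuot {q * q} ((q * q) ^ m) i)) ∷
                    toVec q m (proj₂ (remQuot {q * q} ((q * q) ^ m) i))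

toVec-injective : ∀ q m i j → toVec q m i ≡ toVec q m j → i ≡ j
toVec-injective q zero    zero zero _ = refl
toVec-injective q (suc m) i    j    e with e₁ , e₂ ← ∷-injective e =
  remQuot-injective {q * q} ((q * q) ^ m) i j
    (cong₂ _,_ (remQuot-injective {q} q _ _ e₁) (toVec-injective q m _ _ e₂))

-- Moving and staying in a single round

step-move : ∀ {n} (G : PortGraph n) v {p} → p < deg G v →
            step G v (just p) ≡ (nbr G v p , just (deg G (nbr G v p) , entry G v p))
step-move G v {p} p< with p <ᵇ deg G v | <⇒<ᵇ p<
... | true | _ = refl

step-stay : ∀ {n} (G : PortGraph n) v {p} → ¬ p < deg G v → step G v (just p) ≡ (v , nothing)
step-stay G v {p} ≮ with p <ᵇ deg G v in eq
... | true  = contradiction (<ᵇ⇒< p (deg G v) (subst T (sym eq) tt)) ≮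
... | false = refl

-- Distances certified by a level function

module Levels {n : ℕ} (G : PortGraph n) (s₀ : Fin n) (lev : Fin n → ℕ)
  (lev-start : lev s₀ ≡ 0)
  (lev-zero : ∀ v → lev v ≡ 0 → v ≡ s₀)
  (lev-step : ∀ v p → p < deg G v → lev (nbr G v p) ≤ suc (lev v))
  (lev-down : ∀ v k → lev v ≡ suc k → ∃ λ p → p < deg G v × lev (nbr G v p) ≡ k)
  where

  reach-trans : ∀ {u v w a b} → Reach G u v a → Reach G v w b → Reach G u w (a + b)
  reach-trans ([] , refl , _ , refl) r = r
  reach-trans (p ∷ ps , refl , (p< , va) , e) r
    with qs , l , vb , f ← reach-trans (ps , refl , va , e) r = p ∷ qs , cong suc l , (p< , vb) , f

  -- Descend along `lev-down`; the way back takes the entry ports of the descent in reverse order.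
  reach-start : ∀ k v → lev v ≡ k → Reach G v s₀ k × Reach G s₀ v k
  reach-start zero v e with refl ← lev-zero v e = ([] , refl , tt , refl) , ([] , refl , tt , refl)
  reach-start (suc k) v e with p , p< , e' ← lev-down v k e
    with (ps , l , va , f) , r ← reach-start k (nbr G v p) e' =
      (p ∷ ps , cong suc l , (p< , va) , f) ,
      subst (Reach G s₀ v) (+-comm k 1)
        (reach-trans r (entry G v p ∷ [] , refl , (entry-valid G v p p< , tt) , back-nbr G v p p<))

  lev-walk : ∀ u ps → ValidWalk G u ps → lev (follow G u ps) ≤ length ps + lev u
  lev-walk u [] _ = ≤-refl
  lev-walk u (p ∷ ps) (p< , va) = begin
    lev (follow G (nbr G u p) ps)   ≤⟨ lev-walk (nbr G u p) ps va ⟩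
    length ps + lev (nbr G u p)     ≤⟨ +-monoʳ-≤ (length ps) (lev-step u p p<) ⟩
    length ps + suc (lev u)         ≡⟨ +-suc (length ps) (lev u) ⟩
    suc (length ps + lev u)         ∎
    where open ≤-Reasoning

  -- Descending to level 0 gives a walk of the right length, and since no edge raises the level by
  -- more than 1, no walk from `s₀` gets there sooner.
  dist-lev : ∀ v → Dist G s₀ v (lev v)
  dist-lev v = proj₂ (reach-start _ v refl) , shorter
    where
    shorter : ∀ k → k < lev v → ¬ Reach G s₀ v k
    shorter k k< (ps , refl , va , refl) = <⇒≱ k< (begin
      lev (follow G s₀ ps)  ≤⟨ lev-walk s₀ ps va ⟩
      length ps + lev s₀    ≡⟨ cong (length ps +_) lev-start ⟩
      length ps + 0         ≡⟨ +-identityʳ _ ⟩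
      length ps             ∎)
      where open ≤-Reasoning

  connected-lev : Connected G
  connected-lev u w = _ , reach-trans (proj₁ (reach-start _ u refl)) (proj₂ (reach-start _ w refl))

-- The chain of gadgets as an involution on darts

module Chain (extra : ℕ) where

  s : ℕ
  s = suc (suc extra)

  Choice : Set
  Choice = Fin s × Fin s

  infix 4 _≟ᶜ_
  _≟ᶜ_ : (c d : Choice) → Dec (c ≡ d)
  _≟ᶜ_ = ≡-dec _≟_ _≟_

  -- A chain of m gadgets followed by a path with P edges; its root is nothing, and next v is the node v
  -- of the chain that starts at the second root.
  mutual
    Node : ℕ → ℕ → Set
    Node m P = Maybe (NonRoot m P)

    data NonRoot : ℕ → ℕ → Set where
      left right : ∀ {m P} → Fin s → NonRoot (suc m) P
      next : ∀ {m P} → Node m P → NonRoot (suc m) P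
      tail : ∀ {P} → Node 0 P → NonRoot 0 (suc P)

  rootDeg : ℕ → ℕ → ℕ
  rootDeg zero    zero    = 0
  rootDeg zero    (suc P) = 1
  rootDeg (suc m) P       = s

  -- The root of an inner chain keeps the ports it has there as `inj₁`. Its `inj₂` ports lead back:
  -- to the left and the right end of the edge that it subdivides or, in the tail, to the preceding
  -- node. A left node has `zero` for its root and `suc b` for right node b.
  Port : ∀ {m P} → Node m P → Set
  Port {m} {P} nothing = Fin (rootDeg m P)
  Port (just (left a)) = Fin (suc s)
  Port (just (right b)) = Fin s
  Port {suc m} {P} (just (next nothing)) = Fin (rootDeg m P) ⊎ Fin 2
  Port (just (next (just u))) = Port (just u)
  Port {zero} {suc P} (just (tail nothing)) = Fin (rootDeg zero P) ⊎ Fin 1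
  Port (just (tail (just u))) = Port (just u)

  -- Subdividing an edge keeps the degrees of its ends, so degrees do not betray which edge is
  -- hidden.
  degree : ∀ {m P} → Node m P → ℕ
  degree {m} {P} nothing = rootDeg m P
  degree (just (left a)) = suc s
  degree (just (right b)) = s
  degree {suc m} {P} (just (next nothing)) = rootDeg m P + 2
  degree (just (next (just u))) = degree (just u)
  degree {zero} {suc P} (just (tail nothing)) = rootDeg zero P + 1
  degree (just (tail (just u))) = degree (just u)

  port↔ : ∀ {m P} (v : Node m P) → Port v ↔ Fin (degree v)
  port↔ nothing = ↔-refl
  port↔ (just (left a)) = ↔-refl
  port↔ (just (right b)) = ↔-refl
  port↔ (just (next nothing)) = ↔-sym +↔⊎
  port↔ (just (next (just u))) = port↔ (just u)
  port↔ (just (tail nothing)) = ↔-sym +↔⊎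
  port↔ (just (tail (just u))) = port↔ (just u)

  Dart : ℕ → ℕ → Set
  Dart m P = Σ (Node m P) Port

  portIn : ∀ {m P} (v : Node m P) → Port v → Port (just (next v))
  portIn nothing  p = inj₁ p
  portIn (just u) p = p

  portTail : ∀ {P} (v : Node 0 P) → Port v → Port (just (tail v))
  portTail nothing  p = inj₁ p
  portTail (just u) p = p

  dartIn : ∀ {m P} → Dart m P → Dart (suc m) P
  dartIn (v , p) = just (next v) , portIn v p

  dartTail : ∀ {P} → Dart 0 P → Dart 0 (suc P)
  dartTail (v , p) = just (tail v) , portTail v p

  -- Each dart (a node with one of its ports) goes to its reverse, so the result holds both the node
  -- entered and the entry port. The ends of the hidden edge use the same ports as for a plain edge;
  -- the difference shows only on traversal, which leads to the next root.
  hop : ∀ {m P} → Vec Choice m → Dart m P → Dart m P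
  hop (_ ∷ _) (nothing , a) = just (left a) , zero
  hop (_ ∷ _) (just (left a) , zero) = nothing , a
  hop (c ∷ _) (just (left a) , suc b) with (a , b) ≟ᶜ c
  ... | yes _ = just (next nothing) , inj₂ zero
  ... | no _  = just (right b) , a
  hop (c ∷ _) (just (right b) , a) with (a , b) ≟ᶜ c
  ... | yes _ = just (next nothing) , inj₂ (suc zero)
  ... | no _  = just (left a) , suc b
  hop (_ ∷ cs) (just (next nothing) , inj₁ p) = dartIn (hop cs (nothing , p))
  hop ((α , β) ∷ _) (just (next nothing) , inj₂ zero) = just (left α) , suc β
  hop ((α , β) ∷ _) (just (next nothing) , inj₂ (suc zero)) = just (right β) , α
  hop (_ ∷ cs) (just (next (just u)) , p) = dartIn (hop cs (just u , p))
  hop {P = suc P} [] (nothing , zero) = just (tail nothing) , inj₂ zero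
  hop [] (just (tail nothing) , inj₁ p) = dartTail (hop [] (nothing , p))
  hop [] (just (tail nothing) , inj₂ zero) = nothing , zero
  hop [] (just (tail (just u)) , p) = dartTail (hop [] (just u , p))

  hop-dartIn : ∀ {m P} c (cs : Vec Choice m) (d : Dart m P) → hop (c ∷ cs) (dartIn d) ≡ dartIn (hop cs d)
  hop-dartIn c cs (nothing , p) = refl
  hop-dartIn c cs (just u , p)  = refl

  hop-dartTail : ∀ {P} (d : Dart 0 P) → hop [] (dartTail d) ≡ dartTail (hop [] d)
  hop-dartTail (nothing , p) = refl
  hop-dartTail (just u , p)  = refl

  hop-left-special : ∀ {m P} α β (cs : Vec Choice m) →
                     hop {P = P} ((α , β) ∷ cs) (just (left α) , suc β) ≡ (just (next nothing) , inj₂ zero)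
  hop-left-special α β cs with (α , β) ≟ᶜ (α , β)
  ... | yes _ = refl
  ... | no ≢  = contradiction refl ≢

  hop-right-special : ∀ {m P} α β (cs : Vec Choice m) →
                      hop {P = P} ((α , β) ∷ cs) (just (right β) , α) ≡ (just (next nothing) , inj₂ (suc zero))
  hop-right-special α β cs with (α , β) ≟ᶜ (α , β)
  ... | yes _ = refl
  ... | no ≢  = contradiction refl ≢

  hop-right-plain : ∀ {m P} {a b} c (cs : Vec Choice m) → (a , b) ≢ c →
                hop {P = P} (c ∷ cs) (just (right b) , a) ≡ (just (left a) , suc b)
  hop-right-plain {a = a} {b} c cs ≢ with (a , b) ≟ᶜ c
  ... | yes e = contradiction e ≢
  ... | no _  = refl

  hop-left-plain : ∀ {m P} {a b} c (cs : Vec Choice m) → (a , b) ≢ c →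
                hop {P = P} (c ∷ cs) (just (left a) , suc b) ≡ (just (right b) , a)
  hop-left-plain {a = a} {b} c cs ≢ with (a , b) ≟ᶜ c
  ... | yes e = contradiction e ≢
  ... | no _  = refl

  hop-involutive : ∀ {m P} (cs : Vec Choice m) (d : Dart m P) → hop cs (hop cs d) ≡ d
  hop-involutive (_ ∷ _) (nothing , a) = refl
  hop-involutive (_ ∷ _) (just (left a) , zero) = refl
  hop-involutive (c ∷ cs) (just (left a) , suc b) with (a , b) ≟ᶜ c
  ... | yes refl = refl
  ... | no ≢     = hop-right-plain c cs ≢
  hop-involutive (c ∷ cs) (just (right b) , a) with (a , b) ≟ᶜ c
  ... | yes refl = refl
  ... | no ≢     = hop-left-plain c cs ≢
  hop-involutive (c ∷ cs) (just (next nothing) , inj₁ p) =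
    trans (hop-dartIn c cs (hop cs (nothing , p))) (cong dartIn (hop-involutive cs (nothing , p)))
  hop-involutive ((α , β) ∷ cs) (just (next nothing) , inj₂ zero) = hop-left-special α β cs
  hop-involutive ((α , β) ∷ cs) (just (next nothing) , inj₂ (suc zero)) = hop-right-special α β cs
  hop-involutive (c ∷ cs) (just (next (just u)) , p) =
    trans (hop-dartIn c cs (hop cs (just u , p))) (cong dartIn (hop-involutive cs (just u , p)))
  hop-involutive {P = suc P} [] (nothing , zero) = refl
  hop-involutive [] (just (tail nothing) , inj₁ p) =
    trans (hop-dartTail (hop [] (nothing , p))) (cong dartTail (hop-involutive [] (nothing , p)))
  hop-involutive [] (just (tail nothing) , inj₂ zero) = refl
  hop-involutive [] (just (tail (just u)) , p) =
    trans (hop-dartTail (hop [] (just u , p))) (cong dartTail (hop-involutive [] (just u , p)))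

  next-injective : ∀ {m P} {v w : Node m P} → _≡_ {A = Node (suc m) P} (just (next v)) (just (next w)) → v ≡ w
  next-injective refl = refl

  tail-injective : ∀ {P} {v w : Node 0 P} → _≡_ {A = Node 0 (suc P)} (just (tail v)) (just (tail w)) → v ≡ w
  tail-injective refl = refl

  hop-loopless : ∀ {m P} (cs : Vec Choice m) (d : Dart m P) → proj₁ (hop cs d) ≢ proj₁ d
  hop-loopless (_ ∷ _) (nothing , a) ()
  hop-loopless (_ ∷ _) (just (left a) , zero) ()
  hop-loopless (c ∷ cs) (just (left a) , suc b) e with (a , b) ≟ᶜ c
  hop-loopless (c ∷ cs) (just (left a) , suc b) () | yes _
  hop-loopless (c ∷ cs) (just (left a) , suc b) () | no _
  hop-loopless (c ∷ cs) (just (right b) , a) e with (a , b) ≟ᶜ c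
  hop-loopless (c ∷ cs) (just (right b) , a) () | yes _
  hop-loopless (c ∷ cs) (just (right b) , a) () | no _
  hop-loopless (c ∷ cs) (just (next nothing) , inj₁ p) e = hop-loopless cs (nothing , p) (next-injective e)
  hop-loopless (_ ∷ cs) (just (next nothing) , inj₂ zero) ()
  hop-loopless (_ ∷ cs) (just (next nothing) , inj₂ (suc zero)) ()
  hop-loopless (c ∷ cs) (just (next (just u)) , p) e = hop-loopless cs (just u , p) (next-injective e)
  hop-loopless {P = suc P} [] (nothing , zero) ()
  hop-loopless [] (just (tail nothing) , inj₁ p) e = hop-loopless [] (nothing , p) (tail-injective e)
  hop-loopless [] (just (tail nothing) , inj₂ zero) ()
  hop-loopless [] (just (tail (just u)) , p) e = hop-loopless [] (just u , p) (tail-injective e)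

  -- The next root takes the place of one right neighbour of left node α and of one left neighbour
  -- of right node β, so distinct ports still lead to distinct nodes.
  hop-simple : ∀ {m P} (cs : Vec Choice m) (v : Node m P) (p q : Port v) →
               proj₁ (hop cs (v , p)) ≡ proj₁ (hop cs (v , q)) → p ≡ q
  hop-simple (_ ∷ _) nothing a b refl = refl
  hop-simple (_ ∷ _) (just (left a)) zero zero e = refl
  hop-simple (c ∷ _) (just (left a)) zero (suc q) e with (a , q) ≟ᶜ c
  hop-simple (c ∷ _) (just (left a)) zero (suc q) () | yes _
  hop-simple (c ∷ _) (just (left a)) zero (suc q) () | no _
  hop-simple (c ∷ _) (just (left a)) (suc p) zero e with (a , p) ≟ᶜ c
  hop-simple (c ∷ _) (just (left a)) (suc p) zero () | yes _
  hop-simple (c ∷ _) (just (left a)) (suc p) zero () | no _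
  hop-simple (c ∷ _) (just (left a)) (suc p) (suc q) e with (a , p) ≟ᶜ c | (a , q) ≟ᶜ c
  ... | yes refl | yes refl = refl
  hop-simple (c ∷ _) (just (left a)) (suc p) (suc q) refl | no _ | no _ = refl
  hop-simple (c ∷ _) (just (right b)) p q e with (p , b) ≟ᶜ c | (q , b) ≟ᶜ c
  ... | yes refl | yes refl = refl
  hop-simple (c ∷ _) (just (right b)) p q refl | no _ | no _ = refl
  hop-simple (_ ∷ cs) (just (next nothing)) (inj₁ p) (inj₁ q) e = cong inj₁ (hop-simple cs nothing p q (next-injective e))
  hop-simple (_ ∷ cs) (just (next nothing)) (inj₁ p) (inj₂ zero) ()
  hop-simple (_ ∷ cs) (just (next nothing)) (inj₁ p) (inj₂ (suc zero)) ()
  hop-simple (_ ∷ cs) (just (next nothing)) (inj₂ zero) (inj₁ q) ()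
  hop-simple (_ ∷ cs) (just (next nothing)) (inj₂ (suc zero)) (inj₁ q) ()
  hop-simple (_ ∷ cs) (just (next nothing)) (inj₂ zero) (inj₂ zero) e = refl
  hop-simple (_ ∷ cs) (just (next nothing)) (inj₂ zero) (inj₂ (suc zero)) ()
  hop-simple (_ ∷ cs) (just (next nothing)) (inj₂ (suc zero)) (inj₂ zero) ()
  hop-simple (_ ∷ cs) (just (next nothing)) (inj₂ (suc zero)) (inj₂ (suc zero)) e = refl
  hop-simple (_ ∷ cs) (just (next (just u))) p q e = hop-simple cs (just u) p q (next-injective e)
  hop-simple {P = suc P} [] nothing zero zero e = refl
  hop-simple [] (just (tail nothing)) (inj₁ p) (inj₁ q) e = cong inj₁ (hop-simple [] nothing p q (tail-injective e))
  hop-simple [] (just (tail nothing)) (inj₁ p) (inj₂ zero) ()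
  hop-simple [] (just (tail nothing)) (inj₂ zero) (inj₁ q) ()
  hop-simple [] (just (tail nothing)) (inj₂ zero) (inj₂ zero) e = refl
  hop-simple [] (just (tail (just u))) p q e = hop-simple [] (just u) p q (tail-injective e)

  -- The distance from the root, as `dist-chain` confirms. It does not depend on the hidden edges,
  -- so all choices put the treasure equally far away.
  level : ∀ {m P} → Node m P → ℕ
  level nothing          = 0
  level (just (left a))  = 1
  level (just (right b)) = 2
  level (just (next v))  = 2 + level v
  level (just (tail v))  = 1 + level v

  level-hop : ∀ {m P} (cs : Vec Choice m) (d : Dart m P) → level (proj₁ (hop cs d)) ≤ suc (level (proj₁ d))
  level-hop (_ ∷ _) (nothing , a) = ≤-refl
  level-hop (_ ∷ _) (just (left a) , zero) = z≤n
  level-hop (c ∷ cs) (just (left a) , suc b) with (a , b) ≟ᶜ c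
  ... | yes _ = ≤-refl
  ... | no _  = ≤-refl
  level-hop (c ∷ cs) (just (right b) , a) with (a , b) ≟ᶜ c
  ... | yes _ = n≤1+n 2
  ... | no _  = s≤s z≤n
  level-hop (c ∷ cs) (just (next nothing) , inj₁ p) = s≤s (s≤s (level-hop cs (nothing , p)))
  level-hop (_ ∷ cs) (just (next nothing) , inj₂ zero) = s≤s z≤n
  level-hop (_ ∷ cs) (just (next nothing) , inj₂ (suc zero)) = s≤s (s≤s z≤n)
  level-hop (c ∷ cs) (just (next (just u)) , p) = s≤s (s≤s (level-hop cs (just u , p)))
  level-hop {P = suc P} [] (nothing , zero) = ≤-refl
  level-hop [] (just (tail nothing) , inj₁ p) = s≤s (level-hop [] (nothing , p))
  level-hop [] (just (tail nothing) , inj₂ zero) = z≤n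
  level-hop [] (just (tail (just u)) , p) = s≤s (level-hop [] (just u , p))

  level-down : ∀ {m P} (cs : Vec Choice m) (v : Node m P) → v ≡ nothing ⊎
               ∃ λ p → suc (level (proj₁ (hop cs (v , p)))) ≡ level v
  level-down cs nothing = inj₁ refl
  level-down (_ ∷ _) (just (left a)) = inj₂ (zero , refl)
  -- The edge to left node α may be the subdivided one, so the descent goes through another left
  -- node. One exists because `s` is at least 2.
  level-down ((α , β) ∷ cs) (just (right b)) =
    inj₂ (punchIn α zero , cong (suc ∘ level ∘ proj₁) (hop-right-plain (α , β) cs (punchInᵢ≢i α zero ∘ cong proj₁)))
  level-down (_ ∷ cs) (just (next nothing)) = inj₂ (inj₂ zero , refl)
  level-down (_ ∷ cs) (just (next (just u))) with inj₂ (p , e) ← level-down cs (just u) = inj₂ (p , cong (2 +_) e)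
  level-down [] (just (tail nothing)) = inj₂ (inj₂ zero , refl)
  level-down [] (just (tail (just u))) with inj₂ (p , e) ← level-down [] (just u) = inj₂ (p , cong suc e)

  -- Numbering nodes and ports to obtain a port graph

  size : ℕ → ℕ → ℕ
  size zero    P = suc P
  size (suc m) P = suc (s + (s + size m P))

  encode : ∀ {m P} → Node m P → Fin (size m P)
  encode {zero} nothing = zero
  encode {suc m} {P} nothing = zero
  encode {suc m} {P} (just (left a)) = suc (a ↑ˡ (s + size m P))
  encode {suc m} {P} (just (right b)) = suc (s ↑ʳ (b ↑ˡ size m P))
  encode (just (next v)) = suc (s ↑ʳ (s ↑ʳ encode v))
  encode (just (tail v)) = suc (encode v)

  decode : ∀ {m P} → Fin (size m P) → Node m P
  decode {zero} {zero} zero = nothing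
  decode {zero} {suc P} zero = nothing
  decode {zero} {suc P} (suc i) = just (tail (decode i))
  decode {suc m} {P} zero = nothing
  decode {suc m} {P} (suc i) with splitAt s i
  ... | inj₁ a = just (left a)
  ... | inj₂ j with splitAt s j
  ...   | inj₁ b = just (right b)
  ...   | inj₂ k = just (next (decode k))

  decode-encode : ∀ {m P} (v : Node m P) → decode {m} {P} (encode v) ≡ v
  decode-encode {zero} {zero} nothing = refl
  decode-encode {zero} {suc P} nothing = refl
  decode-encode {suc m} nothing = refl
  decode-encode {suc m} {P} (just (left a)) rewrite splitAt-↑ˡ s a (s + size m P) = refl
  decode-encode {suc m} {P} (just (right b))
    rewrite splitAt-↑ʳ s (s + size m P) (b ↑ˡ size m P) | splitAt-↑ˡ s b (size m P) = refl
  decode-encode {suc m} {P} (just (next v))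
    rewrite splitAt-↑ʳ s (s + size m P) (s ↑ʳ encode v) | splitAt-↑ʳ s (size m P) (encode v) =
      cong (just ∘ next) (decode-encode v)
  decode-encode (just (tail v)) = cong (just ∘ tail) (decode-encode v)

  encode-decode : ∀ {m P} (i : Fin (size m P)) → encode {m} {P} (decode i) ≡ i
  encode-decode {zero} {zero} zero = refl
  encode-decode {zero} {suc P} zero = refl
  encode-decode {zero} {suc P} (suc i) = cong suc (encode-decode i)
  encode-decode {suc m} zero = refl
  encode-decode {suc m} {P} (suc i) with splitAt s i in eq
  ... | inj₁ a = cong suc (splitAt⁻¹-↑ˡ eq)
  ... | inj₂ j with splitAt s j in eq′
  ...   | inj₁ b = cong suc (trans (cong (s ↑ʳ_) (splitAt⁻¹-↑ˡ eq′)) (splitAt⁻¹-↑ʳ eq))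
  ...   | inj₂ k = cong suc (trans (cong (s ↑ʳ_) (trans (cong (s ↑ʳ_) (encode-decode k)) (splitAt⁻¹-↑ʳ eq′))) (splitAt⁻¹-↑ʳ eq))

  toPort : ∀ {m P} (v : Node m P) {p} → p < degree v → Port v
  toPort v p< = Inverse.from (port↔ v) (fromℕ< p<)

  portNumber : ∀ {m P} (v : Node m P) → Port v → ℕ
  portNumber v p = toℕ (Inverse.to (port↔ v) p)

  portNumber< : ∀ {m P} (v : Node m P) p → portNumber v p < degree v
  portNumber< v p = toℕ<n (Inverse.to (port↔ v) p)

  portNumber-toPort : ∀ {m P} (v : Node m P) {p} (p< : p < degree v) → portNumber v (toPort v p<) ≡ p
  portNumber-toPort v p< =
    trans (cong toℕ (Inverse.strictlyInverseˡ (port↔ v) (fromℕ< p<))) (toℕ-fromℕ< p<)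

  toPort-portNumber : ∀ {m P} (v : Node m P) p (p< : portNumber v p < degree v) → toPort v p< ≡ p
  toPort-portNumber v p p< =
    trans (cong (Inverse.from (port↔ v)) (fromℕ<-toℕ (Inverse.to (port↔ v) p) p<))
          (Inverse.strictlyInverseʳ (port↔ v) p)

  number : ∀ {m P} → Dart m P → Node m P × ℕ
  number (v , p) = v , portNumber v p

  hopℕ : ∀ {m P} → Vec Choice m → Node m P → ℕ → Node m P × ℕ
  hopℕ cs v p with p <? degree v
  ... | yes p< = number (hop cs (v , toPort v p<))
  -- A placeholder: `PortGraph` leaves the values at non-existent ports free.
  ... | no _   = v , p

  hopℕ-< : ∀ {m P} (cs : Vec Choice m) (v : Node m P) {p} (p< : p < degree v) →
           hopℕ cs v p ≡ number (hop cs (v , toPort v p<))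
  hopℕ-< cs v {p} p< with p <? degree v
  ... | yes _  = refl
  ... | no ≮   = contradiction p< ≮

  hopℕ-number : ∀ {m P} (cs : Vec Choice m) (d : Dart m P) →
                hopℕ cs (proj₁ d) (proj₂ (number d)) ≡ number (hop cs d)
  hopℕ-number cs (v , p) = trans (hopℕ-< cs v (portNumber< v p))
    (cong (λ q → number (hop cs (v , q))) (toPort-portNumber v p (portNumber< v p)))

  hopℕ-valid : ∀ {m P} (cs : Vec Choice m) (v : Node m P) {p} → p < degree v →
               proj₂ (hopℕ cs v p) < degree (proj₁ (hopℕ cs v p))
  hopℕ-valid cs v p< rewrite hopℕ-< cs v p< =
    portNumber< (proj₁ (hop cs (v , toPort v p<))) (proj₂ (hop cs (v , toPort v p<)))

  -- The two components of this equation become `back-nbr` and `back-entry`.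
  hopℕ-involutive : ∀ {m P} (cs : Vec Choice m) (v : Node m P) {p} → p < degree v →
                    hopℕ cs (proj₁ (hopℕ cs v p)) (proj₂ (hopℕ cs v p)) ≡ (v , p)
  hopℕ-involutive cs v {p} p< rewrite hopℕ-< cs v p< = begin
    hopℕ cs (proj₁ d) (proj₂ (number d))  ≡⟨ hopℕ-number cs d ⟩
    number (hop cs d)                      ≡⟨ cong number (hop-involutive cs (v , toPort v p<)) ⟩
    v , portNumber v (toPort v p<)         ≡⟨ cong (v ,_) (portNumber-toPort v p<) ⟩
    v , p                                  ∎
    where
    open ≡-Reasoning
    d = hop cs (v , toPort v p<)

  encode-injective : ∀ {m P} {v w : Node m P} → encode v ≡ encode w → v ≡ w
  encode-injective {v = v} {w} e = trans (sym (decode-encode v)) (trans (cong decode e) (decode-encode w))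

  chain : ∀ {m P} → Vec Choice m → PortGraph (size m P)
  chain {m} {P} cs = record
    { deg         = λ i → degree (dec i)
    ; nbr         = λ i p → encode (proj₁ (hopℕ cs (dec i) p))
    ; entry       = λ i p → proj₂ (hopℕ cs (dec i) p)
    ; entry-valid = λ i p p< → subst (λ v → proj₂ (hopℕ cs (dec i) p) < degree v)
                      (sym (decode-encode (proj₁ (hopℕ cs (dec i) p)))) (hopℕ-valid cs (dec i) p<)
    ; back-nbr    = λ i p p< → trans (cong (encode ∘ proj₁) (back i p p<)) (encode-decode {m} {P} i)
    ; back-entry  = λ i p p< → cong proj₂ (back i p p<)
    ; loopless    = λ i p p< e → hop-loopless cs (dec i , toPort (dec i) p<)
                      (trans (cong proj₁ (sym (hopℕ-< cs (dec i) p<)))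
                        (trans (sym (decode-encode (proj₁ (hopℕ cs (dec i) p)))) (cong dec e)))
    ; simple      = λ i p q p< q< e →
                      trans (sym (portNumber-toPort (dec i) p<)) (trans (cong (portNumber (dec i))
                        (hop-simple cs (dec i) _ _
                          (trans (cong proj₁ (sym (hopℕ-< cs (dec i) p<)))
                            (trans (encode-injective e) (cong proj₁ (hopℕ-< cs (dec i) q<))))))
                        (portNumber-toPort (dec i) q<))
    }
    where
    dec : Fin (size m P) → Node m P
    dec = decode
    back : ∀ i p → p < degree (dec i) →
           hopℕ cs (dec (encode (proj₁ (hopℕ cs (dec i) p)))) (proj₂ (hopℕ cs (dec i) p)) ≡ (dec i , p)
    back i p p< = trans (cong (λ v → hopℕ cs v (proj₂ (hopℕ cs (dec i) p)))
                          (decode-encode (proj₁ (hopℕ cs (dec i) p))))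
                        (hopℕ-involutive cs (dec i) p<)

  -- Distances in the chain

  module ChainLevels {m P : ℕ} (cs : Vec Choice m) where

    lev : Fin (size m P) → ℕ
    lev i = level (decode {m} {P} i)

    level-zero : ∀ {m P} (v : Node m P) → level v ≡ 0 → v ≡ nothing
    level-zero nothing _ = refl
    level-zero (just (left _)) ()
    level-zero (just (right _)) ()
    level-zero (just (next _)) ()
    level-zero (just (tail _)) ()

    lev-hop : ∀ i p (p< : p < degree (decode {m} {P} i)) →
              lev (nbr (chain {m} {P} cs) i p) ≡
              level (proj₁ (hop cs (decode {m} {P} i , toPort (decode {m} {P} i) p<)))
    lev-hop i p p< = trans (cong level (decode-encode (proj₁ (hopℕ cs (decode i) p))))
                           (cong (level ∘ proj₁) (hopℕ-< cs (decode i) p<))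

    lev-down : ∀ i k → lev i ≡ suc k →
               ∃ λ p → p < degree (decode {m} {P} i) × lev (nbr (chain {m} {P} cs) i p) ≡ k
    lev-down i k e with level-down cs (decode {m} {P} i)
    ... | inj₁ e₀ = contradiction (trans (sym e) (cong level e₀)) λ ()
    ... | inj₂ (p , e′) = portNumber v p , portNumber< v p , (begin
        lev (nbr (chain {m} {P} cs) i (portNumber v p))
          ≡⟨ lev-hop i (portNumber v p) (portNumber< v p) ⟩
        level (proj₁ (hop cs (v , toPort v (portNumber< v p))))
          ≡⟨ cong (λ q → level (proj₁ (hop cs (v , q)))) (toPort-portNumber v p (portNumber< v p)) ⟩
        level (proj₁ (hop cs (v , p)))
          ≡⟨ suc-injective (trans e′ e) ⟩
        k ∎)
      where
      open ≡-Reasoning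
      v = decode {m} {P} i

    lev-zero : ∀ i → lev i ≡ 0 → i ≡ encode {m} {P} nothing
    lev-zero i e = trans (sym (encode-decode {m} {P} i)) (cong encode (level-zero (decode i) e))

    lev-step : ∀ i p → p < degree (decode {m} {P} i) → lev (nbr (chain {m} {P} cs) i p) ≤ suc (lev i)
    lev-step i p p< = ≤-trans (≤-reflexive (lev-hop i p p<)) (level-hop cs (decode i , toPort (decode i) p<))

    open Levels (chain {m} {P} cs) (encode {m} {P} nothing) lev
      (cong level (decode-encode {m} {P} nothing)) lev-zero lev-step lev-down public

    dist-chain : (v : Node m P) → Dist (chain {m} {P} cs) (encode {m} {P} nothing) (encode v) (level v)
    dist-chain v = subst (Dist _ _ (encode v)) (cong level (decode-encode v)) (dist-lev (encode v))

    instanceAt : Node m P → Instance (size m P)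
    instanceAt v = record
      { graph     = chain {m} {P} cs
      ; connected = connected-lev
      ; start     = encode {m} {P} nothing
      ; treasure  = encode v
      }

  -- Chains that differ only in undiscovered hidden edges

  Agree : ∀ {m} → Vec Choice m → Vec Choice m → ℕ → Set
  Agree []       []         _       = ⊤
  Agree (_ ∷ _)  (_ ∷ _)    zero    = ⊤
  Agree (c ∷ cs) (c′ ∷ cs′) (suc k) = c ≡ c′ × Agree cs cs′ k

  agree-zero : ∀ {m} (cs cs′ : Vec Choice m) → Agree cs cs′ 0
  agree-zero []      []      = tt
  agree-zero (_ ∷ _) (_ ∷ _) = tt

  Agree⇒≡ : ∀ {m k} (cs cs′ : Vec Choice m) → m ≤ k → Agree cs cs′ k → cs ≡ cs′
  Agree⇒≡ [] [] _ _ = refl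
  Agree⇒≡ (c ∷ cs) (c′ ∷ cs′) (s≤s m≤k) (refl , ag) = cong (c ∷_) (Agree⇒≡ cs cs′ m≤k ag)

  -- v can be reached by an agent that has traversed the first k hidden edges only.
  Within : ∀ {m P} → Node m P → ℕ → Set
  Within nothing          _       = ⊤
  Within (just (left _))  _       = ⊤
  Within (just (right _)) _       = ⊤
  Within (just (next _))  zero    = ⊥
  Within (just (next v))  (suc k) = Within v k
  Within (just (tail _))  _       = ⊤

  within-tail : ∀ {P} (v : Node 0 P) k → Within v k
  within-tail nothing         _ = tt
  within-tail (just (tail _)) _ = tt

  -- The dart d is the hidden edge of gadget k (counted from 0), traversed towards gadget k + 1.
  discovers : ∀ {m P} → Vec Choice m → Dart m P → ℕ → Bool
  discovers []       _                              _       = false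
  discovers (c ∷ cs) (nothing , _)                  _       = false
  discovers (c ∷ cs) (just (left a) , zero)         _       = false
  discovers (c ∷ cs) (just (left a) , suc b)        zero    = does ((a , b) ≟ᶜ c)
  discovers (c ∷ cs) (just (left a) , suc b)        (suc _) = false
  discovers (c ∷ cs) (just (right b) , a)           zero    = does ((a , b) ≟ᶜ c)
  discovers (c ∷ cs) (just (right b) , a)           (suc _) = false
  discovers (c ∷ cs) (just (next _) , _)            zero    = false
  discovers (c ∷ cs) (just (next nothing) , inj₁ p) (suc k) = discovers cs (nothing , p) k
  discovers (c ∷ cs) (just (next nothing) , inj₂ _) (suc k) = false
  discovers (c ∷ cs) (just (next (just u)) , p)     (suc k) = discovers cs (just u , p) k

  -- Hidden edges are discovered in order, so the number k of discoveries so far is also the index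
  -- of the next one. Past the last gadget nothing is left to discover, which limits a run to m
  -- discoveries.
  discovers⇒< : ∀ {m P} (cs : Vec Choice m) (d : Dart m P) k → discovers cs d k ≡ true → k < m
  discovers⇒< (c ∷ cs) d zero e = s≤s z≤n
  discovers⇒< (c ∷ cs) (just (next nothing) , inj₁ p) (suc k) e = s≤s (discovers⇒< cs (nothing , p) k e)
  discovers⇒< (c ∷ cs) (just (next (just u)) , p) (suc k) e = s≤s (discovers⇒< cs (just u , p) k e)
  discovers⇒< (c ∷ cs) (just (left a) , zero) (suc k) ()
  discovers⇒< (c ∷ cs) (just (left a) , suc b) (suc k) ()

  -- An undiscovered hidden edge looks like any other edge, so runs on two chains stay
  -- identical until one of them traverses a hidden edge that the other does not have.
  hop-agree : ∀ {m P} (cs cs′ : Vec Choice m) (d : Dart m P) k →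
    Agree cs cs′ k → Within (proj₁ d) k → discovers cs d k ≡ discovers cs′ d k →
    hop cs d ≡ hop cs′ d × Agree cs cs′ (bump (discovers cs d k) k) ×
    Within (proj₁ (hop cs d)) (bump (discovers cs d k) k)
  hop-agree [] [] d k ag w _ = refl , tt , within-tail (proj₁ (hop [] d)) k
  hop-agree (c ∷ cs) (c′ ∷ cs′) (nothing , p) k ag w e = refl , ag , tt
  hop-agree (c ∷ cs) (c′ ∷ cs′) (just (left a) , zero) k ag w e = refl , ag , tt
  hop-agree (c ∷ cs) (c′ ∷ cs′) (just (left a) , suc b) zero ag w e with (a , b) ≟ᶜ c | (a , b) ≟ᶜ c′
  ... | yes refl | yes refl = refl , (refl , agree-zero cs cs′) , tt
  ... | no _     | no _     = refl , tt , tt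
  hop-agree (c ∷ cs) (c′ ∷ cs′) (just (right b) , a) zero ag w e with (a , b) ≟ᶜ c | (a , b) ≟ᶜ c′
  ... | yes refl | yes refl = refl , (refl , agree-zero cs cs′) , tt
  ... | no _     | no _     = refl , tt , tt
  hop-agree (c ∷ cs) (.c ∷ cs′) (just (left a) , suc b) (suc k) ag@(refl , _) w e with (a , b) ≟ᶜ c
  ... | yes _ = refl , ag , tt
  ... | no _  = refl , ag , tt
  hop-agree (c ∷ cs) (.c ∷ cs′) (just (right b) , a) (suc k) ag@(refl , _) w e with (a , b) ≟ᶜ c
  ... | yes _ = refl , ag , tt
  ... | no _  = refl , ag , tt
  hop-agree (c ∷ cs) (.c ∷ cs′) (just (next nothing) , inj₂ zero) (suc k) ag@(refl , _) w e = refl , ag , tt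
  hop-agree (c ∷ cs) (.c ∷ cs′) (just (next nothing) , inj₂ (suc zero)) (suc k) ag@(refl , _) w e = refl , ag , tt
  hop-agree (c ∷ cs) (.c ∷ cs′) (just (next nothing) , inj₁ p) (suc k) (refl , ag) w e
    rewrite bump-suc (discovers cs (nothing , p) k) k
    with eq , ag′ , w′ ← hop-agree cs cs′ (nothing , p) k ag w e = cong dartIn eq , (refl , ag′) , w′
  hop-agree (c ∷ cs) (.c ∷ cs′) (just (next (just u)) , p) (suc k) (refl , ag) w e
    rewrite bump-suc (discovers cs (just u , p) k) k
    with eq , ag′ , w′ ← hop-agree cs cs′ (just u , p) k ag w e = cong dartIn eq , (refl , ag′) , w′

  -- Running the algorithm and recording its discoveries

  module Simulation (A : Algorithm) (adv : List Bool) {m P : ℕ} where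

    dec : Fin (size m P) → Node m P
    dec = decode

    G : Vec Choice m → PortGraph (size m P)
    G = chain

    root : Fin (size m P)
    root = encode {m} {P} nothing

    discoversBy : Vec Choice m → Fin (size m P) → Action → ℕ → Bool
    discoversBy cs i nothing  k = false
    discoversBy cs i (just p) k with p <? degree (dec i)
    ... | yes p< = discovers cs (dec i , toPort (dec i) p<) k
    ... | no _   = false

    discoversBy⇒< : ∀ cs i a k → discoversBy cs i a k ≡ true → k < m
    discoversBy⇒< cs i (just p) k e with p <? degree (dec i)
    ... | yes p< = discovers⇒< cs (dec i , toPort (dec i) p<) k e

    discoversBy-move : ∀ cs i {p} k (p< : p < degree (dec i)) →
      discoversBy cs i (just p) k ≡ discovers cs (dec i , toPort (dec i) p<) k
    discoversBy-move cs i {p} k p< with p <? degree (dec i)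
    ... | yes _ = refl
    ... | no ≮  = contradiction p< ≮

    discoversBy-stay : ∀ cs i {p} k → ¬ p < degree (dec i) → discoversBy cs i (just p) k ≡ false
    discoversBy-stay cs i {p} k ≮ with p <? degree (dec i)
    ... | yes p< = contradiction p< ≮
    ... | no _   = refl

    entering : Dart m P → Fin (size m P) × Obs
    entering d = encode (proj₁ d) , just (degree (dec (encode (proj₁ d))) , proj₂ (number d))

    step-hop : ∀ cs i {p} (p< : p < degree (dec i)) →
      step (G cs) i (just p) ≡ entering (hop cs (dec i , toPort (dec i) p<))
    step-hop cs i p< = trans (step-move (G cs) i p<)
      (cong (λ r → encode (proj₁ r) , just (degree (dec (encode (proj₁ r))) , proj₂ r)) (hopℕ-< cs (dec i) p<))

    -- Lifts `hop-agree` from darts to rounds; staying, by choice or for want of the port, discovers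
    -- nothing.
    step-agree : ∀ cs cs′ i a k → Agree cs cs′ k → Within (dec i) k →
      discoversBy cs i a k ≡ discoversBy cs′ i a k →
      step (G cs) i a ≡ step (G cs′) i a × Agree cs cs′ (bump (discoversBy cs i a k) k) ×
      Within (dec (proj₁ (step (G cs) i a))) (bump (discoversBy cs i a k) k)
    step-agree cs cs′ i nothing k ag w e = refl , ag , w
    step-agree cs cs′ i (just p) k ag w e = case (p <? degree (dec i)) e
      where
      case : Dec (p < degree (dec i)) → discoversBy cs i (just p) k ≡ discoversBy cs′ i (just p) k →
        step (G cs) i (just p) ≡ step (G cs′) i (just p) ×
        Agree cs cs′ (bump (discoversBy cs i (just p) k) k) ×
        Within (dec (proj₁ (step (G cs) i (just p)))) (bump (discoversBy cs i (just p) k) k)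
      case (no ≮) _ rewrite step-stay (G cs) i ≮ | step-stay (G cs′) i ≮ | discoversBy-stay cs i k ≮ = refl , ag , w
      case (yes p<) e rewrite step-hop cs i p< | step-hop cs′ i p<
        | discoversBy-move cs i k p< | discoversBy-move cs′ i k p<
        with eq , ag′ , w′ ← hop-agree cs cs′ (dec i , toPort (dec i) p<) k ag w e =
          cong entering eq , ag′ ,
          subst (λ v → Within v (bump (discovers cs d k) k)) (sym (decode-encode (proj₁ (hop cs d)))) w′
          where d = dec i , toPort (dec i) p<

    -- The transcript that will serve as hint: one bit per round, latest first, telling whether the
    -- round traverses the next undiscovered hidden edge. The ones recorded so far give the index of
    -- that edge.
    discoveries : Vec Choice m → ℕ → List Bool
    discoveries cs zero    = []
    discoveries cs (suc t) with run (G cs) A adv root t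
    ... | i , h = discoversBy cs i (A adv (deg (G cs) root) h) (ones (discoveries cs t)) ∷ discoveries cs t

    length-discoveries : ∀ cs t → length (discoveries cs t) ≡ t
    length-discoveries cs zero    = refl
    length-discoveries cs (suc t) = cong suc (length-discoveries cs t)

    ones-discoveries : ∀ cs t → ones (discoveries cs t) ≤ m
    ones-discoveries cs zero = z≤n
    ones-discoveries cs (suc t) with run (G cs) A adv root t
    ... | i , h with discoversBy cs i (A adv (deg (G cs) root) h) (ones (discoveries cs t)) in e
    ...   | true  = discoversBy⇒< cs i (A adv (deg (G cs) root) h) _ e
    ...   | false = ones-discoveries cs t

    discoveries-≤ : ∀ cs cs′ {t u} → t ≤′ u → discoveries cs u ≡ discoveries cs′ u →
                    discoveries cs t ≡ discoveries cs′ t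
    discoveries-≤ cs cs′ ≤′-refl       e = e
    discoveries-≤ cs cs′ (≤′-step t≤u) e = discoveries-≤ cs cs′ t≤u (∷-injectiveʳ e)

    -- For fixed advice the transcript determines the run. A common zero means that no new hidden
    -- edge is traversed in either chain, so the round looks the same in both; a common one
    -- identifies the same hidden edge in both, and the agreement grows by one gadget.
    run-agree : ∀ cs cs′ t → discoveries cs t ≡ discoveries cs′ t →
      run (G cs) A adv root t ≡ run (G cs′) A adv root t × Agree cs cs′ (ones (discoveries cs t)) ×
      Within (dec (position (G cs) A adv root t)) (ones (discoveries cs t))
    run-agree cs cs′ zero e =
      refl , agree-zero cs cs′ , subst (λ v → Within v 0) (sym (decode-encode {m} {P} nothing)) tt
    run-agree cs cs′ (suc t) e with run-agree cs cs′ t (∷-injectiveʳ e)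
    ... | eq , ag , w with run (G cs) A adv root t | run (G cs′) A adv root t
    run-agree cs cs′ (suc t) e | refl , ag , w | i , h | .(i , h)
      with step-agree cs cs′ i act (ones (discoveries cs t)) ag w
             -- The latest bits refer to the same gadget in both chains, because the earlier bits
             -- coincide.
             (trans (∷-injectiveˡ e) (cong (λ bs → discoversBy cs′ i act (ones bs)) (sym (∷-injectiveʳ e))))
      where act = A adv (deg (G cs) root) h
    ... | eq , ag′ , w′ = cong (λ r → proj₁ r , proj₂ r ∷ h) eq , ag′ , w′

  -- Instances with the treasure behind all gadgets

  treasureAt : ∀ m ℓ {r} → Node m (ℓ + r)
  treasureAt zero    zero    = nothing
  treasureAt zero    (suc ℓ) = just (tail (treasureAt zero ℓ))
  treasureAt (suc m) ℓ       = just (next (treasureAt m ℓ))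

  level-treasureAt : ∀ m ℓ {r} → level (treasureAt m ℓ {r}) ≡ m * 2 + ℓ
  level-treasureAt zero    zero    = refl
  level-treasureAt zero    (suc ℓ) = cong suc (level-treasureAt zero ℓ)
  level-treasureAt (suc m) ℓ       = cong (2 +_) (level-treasureAt m ℓ)

  within-treasureAt : ∀ m ℓ {r} k → Within (treasureAt m ℓ {r}) k → m ≤ k
  within-treasureAt zero    ℓ k       w = z≤n
  within-treasureAt (suc m) ℓ (suc k) w = s≤s (within-treasureAt m ℓ k w)

  open ChainLevels using (instanceAt; dist-chain)

  -- The treasure lies ℓ edges into the tail: ℓ adjusts the distance, and the r tail nodes beyond it
  -- adjust the number of nodes.
  hunt : ∀ m ℓ r → Vec Choice m → Instance (size m (ℓ + r))
  hunt m ℓ r cs = instanceAt {m} {ℓ + r} cs (treasureAt m ℓ)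

  dist-hunt : ∀ m ℓ r (cs : Vec Choice m) →
    Dist (graph (hunt m ℓ r cs)) (start (hunt m ℓ r cs)) (treasure (hunt m ℓ r cs)) (m * 2 + ℓ)
  dist-hunt m ℓ r cs = subst (Dist _ _ _) (level-treasureAt m ℓ {r}) (dist-chain cs (treasureAt m ℓ {r}))

  module _ (A : Algorithm) (adv : List Bool) (m ℓ r : ℕ) where
    open Simulation A adv {m} {ℓ + r}

    -- The treasure is behind all m gadgets, so reaching it takes m discoveries. By then the chain
    -- whose transcript coincides has been forced to have the same m hidden edges.
    solved-injective : ∀ cs cs′ T → ReachesWithin A adv (hunt m ℓ r cs) T →
                       discoveries cs T ≡ discoveries cs′ T → cs ≡ cs′
    solved-injective cs cs′ T (t , t≤T , e) eq
      with _ , ag , w ← run-agree cs cs′ t (discoveries-≤ cs cs′ (≤⇒≤′ t≤T) eq) =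
        Agree⇒≡ cs cs′ (within-treasureAt m ℓ {r} (ones (discoveries cs t))
          (subst (λ v → Within v (ones (discoveries cs t))) (trans (cong dec e) (decode-encode (treasureAt m ℓ {r}))) w)) ag

-- Logarithms and room for the gadgets

2^⌊log₂⌋≤ : ∀ n .{{_ : NonZero n}} → 2 ^ ⌊log₂ n ⌋ ≤ n
2^⌊log₂⌋≤ n = bound ⌊log₂ n ⌋ n refl
  where
  bound : ∀ l n .{{_ : NonZero n}} → ⌊log₂ n ⌋ ≡ l → 2 ^ l ≤ n
  bound zero    n@(suc _)        _ = s≤s z≤n
  bound (suc l) n@(suc (suc n′)) e = begin
    2 * 2 ^ l              ≤⟨ *-monoʳ-≤ 2 (bound l ⌊ n /2⌋ (trans (⌊log₂⌊n/2⌋⌋≡⌊log₂n⌋∸1 n) (cong (_∸ 1) e))) ⟩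
    2 * ⌊ n /2⌋            ≡⟨ cong (⌊ n /2⌋ +_) (+-identityʳ ⌊ n /2⌋) ⟩
    ⌊ n /2⌋ + ⌊ n /2⌋      ≤⟨ +-monoʳ-≤ ⌊ n /2⌋ (⌊n/2⌋≤⌈n/2⌉ n) ⟩
    ⌊ n /2⌋ + ⌈ n /2⌉      ≡⟨ ⌊n/2⌋+⌈n/2⌉≡n n ⟩
    n                      ∎
    where open ≤-Reasoning

n<2^n : ∀ n → n < 2 ^ n
n<2^n zero    = s≤s z≤n
n<2^n (suc n) = begin-strict
  suc n          ≤⟨ n<2^n n ⟩
  2 ^ n          <⟨ m<m*n (2 ^ n) 2 {{m^n≢0 2 n}} (s≤s (s≤s z≤n)) ⟩
  2 ^ n * 2      ≡⟨ *-comm (2 ^ n) 2 ⟩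
  2 * 2 ^ n      ∎
  where open ≤-Reasoning

size-≡ : ∀ extra m P → Chain.size extra m P ≡ m * (1 + 2 * (2 + extra)) + suc P
size-≡ extra zero    P = refl
size-≡ extra (suc m) P =
  trans (cong (λ z → suc (2 + extra + (2 + extra + z))) (size-≡ extra m P)) (regroup extra (m * (1 + 2 * (2 + extra))) P)
  where
  regroup : ∀ extra a P → suc (2 + extra + (2 + extra + (a + suc P))) ≡ 1 + 2 * (2 + extra) + a + suc P
  regroup = solve-∀

slack : ∀ a b {n} → a + b ≤ n → ∃ λ r → a + (b + r) ≡ n
slack a b a+b≤n with r , e ← m≤n⇒∃[o]m+o≡n a+b≤n = r , trans (sym (+-assoc a b r)) e

-- With S = 2 + `extra`, the gadgets and the tail up to the treasure have m (1 + 2S) + ℓ + 1 nodes,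
-- at most 2Sm + (2m + ℓ) since m ≥ 1. Half of n pays for 2Sm, the other half for 2m + ℓ = D; what
-- remains lengthens the tail.
fits : ∀ {n D m extra} .{{_ : NonZero m}} → m * 2 ≤ D → 2 * D ≤ n → 4 * (2 + extra) * m ≤ n →
       ∃₂ λ ℓ r → m * 2 + ℓ ≡ D × Chain.size extra m (ℓ + r) ≡ n
fits {n} {D} {m@(suc m′)} {extra} 2m≤D 2D≤n 4sm≤n
  with ℓ , refl ← m≤n⇒∃[o]m+o≡n 2m≤D = ℓ , proj₁ rest , refl , trans (size-≡ extra m (ℓ + proj₁ rest)) (proj₂ rest)
  where
  open ≤-Reasoning
  S = 2 + extra
  regroup : ∀ m S ℓ → suc m * (1 + 2 * S) + suc ℓ + m ≡ 2 * S * suc m + (suc m * 2 + ℓ)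
  regroup = solve-∀
  double : ∀ a b m → 2 * (2 * a * m + b) ≡ 4 * a * m + 2 * b
  double = solve-∀
  room : m * (1 + 2 * S) + suc ℓ ≤ n
  room = *-cancelˡ-≤ 2 (begin
    2 * (m * (1 + 2 * S) + suc ℓ)        ≤⟨ *-monoʳ-≤ 2 (m≤m+n (m * (1 + 2 * S) + suc ℓ) m′) ⟩
    2 * (m * (1 + 2 * S) + suc ℓ + m′)   ≡⟨ cong (2 *_) (regroup m′ S ℓ) ⟩
    2 * (2 * S * m + (m * 2 + ℓ))        ≡⟨ double S (m * 2 + ℓ) m ⟩
    4 * S * m + 2 * (m * 2 + ℓ)          ≤⟨ +-mono-≤ 4sm≤n 2D≤n ⟩
    n + n                                ≡⟨ cong (n +_) (+-identityʳ n) ⟨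
    2 * n                                ∎)
  rest : ∃ λ r → m * (1 + 2 * S) + suc (ℓ + r) ≡ n
  rest = slack (m * (1 + 2 * S)) (suc ℓ) room

n/D≢0 : ∀ {n D} .{{_ : NonZero D}} → 2 * D ≤ n → NonZero (n / D)
n/D≢0 {n} {D} 2D≤n = >-nonZero (m≥n⇒m/n>0 (≤-trans (m≤m+n D (D + 0)) 2D≤n))

-- Instances that force long advice

HardInstance : Oracle → (n D L : ℕ) → Set
HardInstance O n D L =
  ∃ λ (I : Instance n) → Dist (graph I) (start I) (treasure I) D × L ≤ length (O n I)

module _ (A : Algorithm) (O : Oracle) (c : ℕ) (solves : SolvesInLinearTime A O c) where

  -- R is the number of rounds available per gadget. The m-th power of the last hypothesis compares
  -- the transcripts, at most (4R)ᵐ, times 2 to the L m with the s²ᵐ choices of hidden edges.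
  chain-advice : ∀ extra m .{{_ : NonZero m}} ℓ r R .{{_ : NonZero R}} L → let open Chain extra in
    c * (m * 2 + ℓ) ≤ R * m → 4 * R * 2 ^ L < s * s →
    HardInstance O (size m (ℓ + r)) (m * 2 + ℓ) (L * m)
  chain-advice extra m ℓ r R L time few =
    hunt m ℓ r (cs (proj₁ long)) , dist-hunt m ℓ r (cs (proj₁ long)) , proj₂ long
    where
    open Chain extra
    cs : Fin ((s * s) ^ m) → Vec Choice m
    cs = toVec s m
    advice : Fin ((s * s) ^ m) → List Bool
    advice i = O _ (hunt m ℓ r (cs i))
    discoveries = λ adv → Simulation.discoveries A adv {m} {ℓ + r}
    hint : Fin ((s * s) ^ m) → List Bool
    hint i = discoveries (advice i) (cs i) (R * m)
    hint∈ : ∀ i → hint i ∈ words (R * m) m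
    hint∈ i = subst (λ T → hint i ∈ words T m) (Simulation.length-discoveries A (advice i) {m} {ℓ + r} (cs i) (R * m))
      (∈-words (hint i) (Simulation.ones-discoveries A (advice i) {m} {ℓ + r} (cs i) (R * m)))
    inj : ∀ i j → advice i ≡ advice j → hint i ≡ hint j → i ≡ j
    -- Each transcript is recorded under the instance's own advice; equal advice puts both under one
    -- string, as `solved-injective` demands.
    inj i j adv≡ hint≡ with t , t≤ , e ← solves _ (hunt m ℓ r (cs i)) (m * 2 + ℓ) (dist-hunt m ℓ r (cs i)) =
      toVec-injective s m i j (solved-injective A (advice i) m ℓ r (cs i) (cs j) (R * m)
        (t , ≤-trans t≤ time , e)
        (trans hint≡ (cong (λ adv → discoveries adv (cs j) (R * m)) (sym adv≡))))
    few′ : length (words (R * m) m) * 2 ^ (L * m) < (s * s) ^ m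
    few′ = begin-strict
      length (words (R * m) m) * 2 ^ (L * m)  ≤⟨ *-monoˡ-≤ (2 ^ (L * m)) (length-words-≤ R m) ⟩
      (4 * R) ^ m * 2 ^ (L * m)               ≡⟨ cong ((4 * R) ^ m *_) (^-*-assoc 2 L m) ⟨
      (4 * R) ^ m * (2 ^ L) ^ m               ≡⟨ ^-distribʳ-* m (4 * R) (2 ^ L) ⟨
      (4 * R * 2 ^ L) ^ m                     <⟨ ^-monoˡ-< m few ⟩
      (s * s) ^ m                             ∎
      where open ≤-Reasoning
    long : ∃ λ i → L * m ≤ length (advice i)
    long = long-advice advice (words (R * m) m) hint hint∈ inj few′

  -- The graph is the same for all s positions of the treasure, so advice and round number determine
  -- where the agent is. The finishing time, one of c + 1 values, therefore works as hint.
  neighbour-advice : ∀ extra r L → let open Chain extra in suc c * 2 ^ L < s →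
    HardInstance O (size 1 r) 1 L
  neighbour-advice extra r L few = at (proj₁ long) , dist (proj₁ long) , proj₂ long
    where
    open Chain extra
    cs : Vec Choice 1
    cs = (zero , zero) ∷ []
    at : Fin s → Instance (size 1 r)
    at a = ChainLevels.instanceAt {1} {r} cs (just (left a))
    dist : ∀ a → Dist (graph (at a)) (start (at a)) (treasure (at a)) 1
    dist a = ChainLevels.dist-chain {1} {r} cs (just (left a))
    advice : Fin s → List Bool
    advice a = O _ (at a)
    solved : ∀ a → ReachesWithin A (advice a) (at a) (c * 1)
    solved a = solves _ (at a) 1 (dist a)
    time : Fin s → ℕ
    time a = proj₁ (solved a)
    time∈ : ∀ a → time a ∈ upTo (suc c)
    time∈ a = ∈-upTo⁺ (s≤s (subst (time a ≤_) (*-identityʳ c) (proj₁ (proj₂ (solved a)))))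
    inj : ∀ a b → advice a ≡ advice b → time a ≡ time b → a ≡ b
    inj a b adv≡ time≡ = left-injective (encode-injective {1} {r} (begin
      encode {1} {r} (just (left a))  ≡⟨ proj₂ (proj₂ (solved a)) ⟨
      position (chain {1} {r} cs) A (advice a) (encode {1} {r} nothing) (time a)
        ≡⟨ cong₂ (λ adv t → position (chain {1} {r} cs) A adv (encode {1} {r} nothing) t) adv≡ time≡ ⟩
      position (chain {1} {r} cs) A (advice b) (encode {1} {r} nothing) (time b)  ≡⟨ proj₂ (proj₂ (solved b)) ⟩
      encode {1} {r} (just (left b))  ∎))
      where
      open ≡-Reasoning
      left-injective : ∀ {a b : Fin s} → _≡_ {A = Node 1 r} (just (left a)) (just (left b)) → a ≡ b
      left-injective refl = refl
    long : ∃ λ a → L ≤ length (advice a)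
    long = long-advice advice (upTo (suc c)) time time∈ inj
             (subst (λ z → z * 2 ^ L < s) (sym (length-upTo (suc c))) few)

  advice-≥ : ∀ {n D} m .{{_ : NonZero m}} S R .{{_ : NonZero R}} L →
    m * 2 ≤ D → 2 * D ≤ n → 4 * S * m ≤ n → c * D ≤ R * m → 4 * R * 2 ^ L < S * S →
    HardInstance O n D (L * m)
  -- A gadget needs S ≥ 2; smaller S is excluded because 4R times a power of 2 is at least 1.
  advice-≥ m 0 R L _ _ _ _ ()
  advice-≥ m 1 R L _ _ _ _ few =
    contradiction few (≤⇒≯ (>-nonZero⁻¹ (4 * R * 2 ^ L) {{m*n≢0 (4 * R) (2 ^ L) {{m*n≢0 4 R}} {{m^n≢0 2 L}}}}))
  advice-≥ m (suc (suc extra)) R L 2m≤D 2D≤n 4sm≤n time few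
    with ℓ , r , refl , refl ← fits {m = m} {extra} 2m≤D 2D≤n 4sm≤n = chain-advice extra m ℓ r R L time few

  -- The length L = c + 3 + e satisfies c + L + 3 = ⌊log₂ n⌋. With X = 2 to the c + L, a gadget with
  -- 2 + X left nodes and one tail node has 6 + 2X ≤ 8X ≤ n nodes, and c + 1 ≤ 2ᶜ accounts for the
  -- finishing times.
  neighbour-advice-≥ : ∀ n .{{_ : NonZero n}} e → c + c + 6 + e ≡ ⌊log₂ n ⌋ →
    HardInstance O n 1 (c + 3 + e)
  neighbour-advice-≥ n e log≡ =
    subst (λ n → HardInstance O n 1 L)
      (trans (size-≡ X 1 r) (proj₂ rest))
      (neighbour-advice X r L few)
    where
    open ≤-Reasoning
    L = c + 3 + e
    X = 2 ^ (c + L)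
    few : suc c * 2 ^ L < 2 + X
    few = begin-strict
      suc c * 2 ^ L  ≤⟨ *-monoˡ-≤ (2 ^ L) (n<2^n c) ⟩
      2 ^ c * 2 ^ L  ≡⟨ ^-distribˡ-+-* 2 c L ⟨
      X              <⟨ m<n+m X {2} (s≤s z≤n) ⟩
      2 + X          ∎
    expand : ∀ X → 1 * (1 + 2 * (2 + X)) + 1 ≡ 6 * 1 + 2 * X
    expand = solve-∀
    eight : ∀ X → 6 * X + 2 * X ≡ X * 8
    eight = solve-∀
    exponent : ∀ c e → c + (c + 3 + e) + 3 ≡ c + c + 6 + e
    exponent = solve-∀
    room : 1 * (1 + 2 * (2 + X)) + 1 ≤ n
    room = begin
      1 * (1 + 2 * (2 + X)) + 1  ≡⟨ expand X ⟩
      6 * 1 + 2 * X              ≤⟨ +-monoˡ-≤ (2 * X) (*-monoʳ-≤ 6 (m^n>0 2 (c + L))) ⟩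
      6 * X + 2 * X              ≡⟨ eight X ⟩
      X * 2 ^ 3                  ≡⟨ ^-distribˡ-+-* 2 (c + L) 3 ⟨
      2 ^ (c + L + 3)            ≡⟨ cong (2 ^_) (trans (exponent c e) log≡) ⟩
      2 ^ ⌊log₂ n ⌋              ≤⟨ 2^⌊log₂⌋≤ n ⟩
      n                          ∎
    rest = slack (1 * (1 + 2 * (2 + X))) 1 room
    r = proj₁ rest

  -- Choosing the number and the width of gadgets

  module _ (K′ : ℕ) .{{_ : NonZero K′}} where

    -- K bounds the distance per gadget, D ≤ K m, and is also the factor lost in the final bound.
    -- Then c D ≤ R m; taking c + 1 in place of c keeps R positive.
    K R : ℕ
    K = 8 * K′
    R = suc c * K

    instance
      K≢0 : NonZero K
      K≢0 = m*n≢0 8 K′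
      R≢0 : NonZero R
      R≢0 = m*n≢0 (suc c) K

    2≤K : 2 ≤ K
    2≤K = ≤-trans (s≤s (s≤s z≤n)) (m≤m*n 8 K′)

    Bound : ℕ → (D : ℕ) .{{_ : NonZero D}} → Set
    Bound n D = ∃ λ (I : Instance n) →
      Dist (graph I) (start I) (treasure I) D × D * ⌊log₂ (n / D) ⌋ ≤ K * length (O n I)

    -- The advice length c + 3 + e is at least half of ⌊log₂ n⌋ = 2c + 6 + e, and K ≥ 2 makes up for
    -- the half.
    bound-D≡1 : ∀ n → 2 ^ (c + c + 6) ≤ n → Bound n 1
    bound-D≡1 n large = proj₁ hard , proj₁ (proj₂ hard) , (begin
        1 * ⌊log₂ (n / 1) ⌋            ≡⟨ *-identityˡ ⌊log₂ (n / 1) ⌋ ⟩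
        ⌊log₂ (n / 1) ⌋                ≡⟨ cong ⌊log₂_⌋ (n/1≡n n) ⟩
        ⌊log₂ n ⌋                      ≡⟨ proj₂ rest ⟨
        c + c + 6 + e                  ≤⟨ m≤m+n (c + c + 6 + e) e ⟩
        c + c + 6 + e + e              ≡⟨ double c e ⟩
        2 * (c + 3 + e)                ≤⟨ *-mono-≤ 2≤K (proj₂ (proj₂ hard)) ⟩
        K * length (O n (proj₁ hard))  ∎)
      where
      open ≤-Reasoning
      log-large : c + c + 6 ≤ ⌊log₂ n ⌋
      log-large = subst (_≤ ⌊log₂ n ⌋) (⌊log₂[2^n]⌋≡n (c + c + 6)) (⌊log₂⌋-mono-≤ large)
      rest : ∃ λ e → c + c + 6 + e ≡ ⌊log₂ n ⌋
      rest = m≤n⇒∃[o]m+o≡n log-large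
      e : ℕ
      e = proj₁ rest
      hard : HardInstance O n 1 (c + 3 + e)
      hard = neighbour-advice-≥ n {{>-nonZero (≤-trans (m^n>0 2 (c + c + 6)) large)}} e (proj₂ rest)
      double : ∀ c e → c + c + 6 + e + e ≡ 2 * (c + 3 + e)
      double = solve-∀

    bound-by : ∀ {n D} .{{_ : NonZero D}} m .{{_ : NonZero m}} S → 2 * D ≤ n →
      m * 2 ≤ D → D ≤ K * m → 4 * S * m ≤ n → 4 * R * 2 ^ ⌊log₂ (n / D) ⌋ < S * S → Bound n D
    bound-by {n} {D} m S 2D≤n 2m≤D D≤Km 4Sm≤n few = I , proj₁ (proj₂ found) , (begin
        D * L                 ≤⟨ *-monoˡ-≤ L D≤Km ⟩
        K * m * L             ≡⟨ *-assoc K m L ⟩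
        K * (m * L)           ≡⟨ cong (K *_) (*-comm m L) ⟩
        K * (L * m)           ≤⟨ *-monoʳ-≤ K (proj₂ (proj₂ found)) ⟩
        K * length (O n I)    ∎)
      where
      open ≤-Reasoning
      L = ⌊log₂ (n / D) ⌋
      time : c * D ≤ R * m
      time = begin
        c * D            ≤⟨ *-mono-≤ (n≤1+n c) D≤Km ⟩
        suc c * (K * m)  ≡⟨ *-assoc (suc c) K m ⟨
        R * m            ∎
      found = advice-≥ m S R L 2m≤D 2D≤n 4Sm≤n time few
      I = proj₁ found

    -- With q = n / D and S = q K′, the value K′ = 64 (c + 1) gives S² = 64 (c + 1) K′ q², at least
    -- twice 4Rq = 32 (c + 1) K′ q. This holds for every q ≥ 1, so also when n / D stays bounded.
    bound-large-D : ∀ {n D} .{{_ : NonZero D}} → K′ ≡ 64 * suc c → 2 * D ≤ n → K ≤ D → Bound n D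
    bound-large-D {n} {D} K′≡ 2D≤n K≤D = bound-by m (q * K′) 2D≤n 2m≤D D≤Km 4Sm≤n few
      where
      open ≤-Reasoning
      q = n / D
      -- Rounding up ensures D ≤ K m. Since K ≤ D, still K m ≤ 2D, that is, 4 K′ m ≤ D, which leaves
      -- room for gadgets of width q K′.
      m = suc (D / K)
      4K′m≤D : 4 * K′ * m ≤ D
      4K′m≤D = *-cancelˡ-≤ 2 (begin
        2 * (4 * K′ * m)  ≡⟨ shuffle K′ (D / K) ⟩
        K + (D / K) * K   ≤⟨ +-mono-≤ K≤D (m/n*n≤m D K) ⟩
        D + D             ≡⟨ cong (D +_) (+-identityʳ D) ⟨
        2 * D             ∎)
        where
        shuffle : ∀ a b → 2 * (4 * a * suc b) ≡ 8 * a + b * (8 * a)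
        shuffle = solve-∀
      2m≤D : m * 2 ≤ D
      2m≤D = begin
        m * 2         ≡⟨ *-comm m 2 ⟩
        2 * m         ≤⟨ *-monoˡ-≤ m (≤-trans (s≤s (s≤s z≤n)) (m≤m*n 4 K′)) ⟩
        4 * K′ * m    ≤⟨ 4K′m≤D ⟩
        D             ∎
      D≤Km : D ≤ K * m
      D≤Km = begin
        D                    ≡⟨ m≡m%n+[m/n]*n D K ⟩
        D % K + D / K * K    ≤⟨ +-monoˡ-≤ (D / K * K) (m%n≤n D K) ⟩
        K + D / K * K        ≡⟨ *-comm m K ⟩
        K * m                ∎
      4Sm≤n : 4 * (q * K′) * m ≤ n
      4Sm≤n = begin
        4 * (q * K′) * m    ≡⟨ shuffle q K′ m ⟩
        q * (4 * K′ * m)    ≤⟨ *-monoʳ-≤ q 4K′m≤D ⟩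
        q * D               ≤⟨ m/n*n≤m n D ⟩
        n                   ∎
        where
        shuffle : ∀ a b c → 4 * (a * b) * c ≡ a * (4 * b * c)
        shuffle = solve-∀
      instance
        q≢0 : NonZero q
        q≢0 = n/D≢0 2D≤n
      few : 4 * R * 2 ^ ⌊log₂ q ⌋ < q * K′ * (q * K′)
      few = begin-strict
        4 * R * 2 ^ ⌊log₂ q ⌋   ≤⟨ *-monoʳ-≤ (4 * R) (2^⌊log₂⌋≤ q) ⟩
        4 * R * q               <⟨ m<m*n (4 * R * q) 2 {{m*n≢0 (4 * R) q {{m*n≢0 4 R}}}} (s≤s (s≤s z≤n)) ⟩
        4 * R * q * 2           ≤⟨ m≤m*n (4 * R * q * 2) q ⟩
        4 * R * q * 2 * q       ≡⟨ shuffle (suc c) K′ q ⟩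
        q * K′ * (q * (64 * suc c))   ≡⟨ cong (λ z → q * K′ * (q * z)) K′≡ ⟨
        q * K′ * (q * K′)       ∎
        where
        shuffle : ∀ c K′ q → 4 * (c * (8 * K′)) * q * 2 * q ≡ q * K′ * (q * (64 * c))
        shuffle = solve-∀

    -- For D ≤ K one gadget is enough, with S about n/4. As n / D ≤ n ≤ 8S, the left side is at most
    -- 32 R S, below S² once S exceeds 32R; this is what the threshold on n provides.
    bound-small-D : ∀ {n D} .{{_ : NonZero D}} → (1 + 32 * R) * 4 ≤ n → 2 * D ≤ n → 2 ≤ D → D ≤ K → Bound n D
    bound-small-D {n} {D} large 2D≤n 2≤D D≤K =
      bound-by 1 S 2D≤n 2≤D (≤-trans D≤K (≤-reflexive (sym (*-identityʳ K)))) 4S≤n few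
      where
      open ≤-Reasoning
      S = n / 4
      32R<S : 32 * R < S
      32R<S = subst (_≤ S) (m*n/n≡m (1 + 32 * R) 4) (/-monoˡ-≤ 4 large)
      4S≤n : 4 * S * 1 ≤ n
      4S≤n = begin
        4 * S * 1  ≡⟨ trans (*-identityʳ (4 * S)) (*-comm 4 S) ⟩
        S * 4      ≤⟨ m/n*n≤m n 4 ⟩
        n          ∎
      -- The remainder modulo 4 is at most 4, hence at most 4S, because S is positive.
      n≤8S : n ≤ 8 * S
      n≤8S = begin
        n                ≡⟨ m≡m%n+[m/n]*n n 4 ⟩
        n % 4 + S * 4    ≤⟨ +-monoˡ-≤ (S * 4) (m%n≤n n 4) ⟩
        4 * 1 + S * 4    ≤⟨ +-monoˡ-≤ (S * 4) (*-monoʳ-≤ 4 (≤-trans (s≤s z≤n) 32R<S)) ⟩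
        4 * S + S * 4    ≡⟨ eight S ⟩
        8 * S            ∎
        where
        eight : ∀ S → 4 * S + S * 4 ≡ 8 * S
        eight = solve-∀
      few : 4 * R * 2 ^ ⌊log₂ (n / D) ⌋ < S * S
      few = begin-strict
        4 * R * 2 ^ ⌊log₂ (n / D) ⌋   ≤⟨ *-monoʳ-≤ (4 * R) (2^⌊log₂⌋≤ (n / D) {{n/D≢0 2D≤n}}) ⟩
        4 * R * (n / D)               ≤⟨ *-monoʳ-≤ (4 * R) (m/n≤m n D) ⟩
        4 * R * n                     ≤⟨ *-monoʳ-≤ (4 * R) n≤8S ⟩
        4 * R * (8 * S)               ≡⟨ shuffle R S ⟩
        32 * R * S                    <⟨ *-monoˡ-< S {{>-nonZero (≤-trans (s≤s z≤n) 32R<S)}} 32R<S ⟩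
        S * S                         ∎
        where
        shuffle : ∀ R S → 4 * R * (8 * S) ≡ 32 * R * S
        shuffle = solve-∀

theorem2 : (A : Algorithm) (O : Oracle) →
    ∃ (λ c → SolvesInLinearTime A O c) →
    ∃₂ λ k n₀ → ∀ (n D : ℕ) .{{_ : NonZero D}} → n₀ ≤ n → 2 * D ≤ n →
    ∃ λ (I : Instance n) →
    Dist (graph I) (start I) (treasure I) D ×
    D * ⌊log₂ (n / D) ⌋ ≤ k * length (O n I)
-- The threshold on n adds those of the cases D = 1 and 2 ≤ D ≤ K; the value of K′ is the one
-- `bound-large-D` asks for.
theorem2 A O (c , solves) = 8 * K′ , 2 ^ (c + c + 6) + (1 + 32 * R A O c solves K′) * 4 , bound
  where
  K′ = 64 * suc c
  bound : ∀ n D .{{_ : NonZero D}} → 2 ^ (c + c + 6) + (1 + 32 * R A O c solves K′) * 4 ≤ n → 2 * D ≤ n →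
          Bound A O c solves K′ n D
  bound n 1 large _ = bound-D≡1 A O c solves K′ n (≤-trans (m≤m+n _ _) large)
  bound n D@(suc (suc _)) large 2D≤n with ≤-total (8 * K′) D
  ... | inj₁ K≤D = bound-large-D A O c solves K′ refl 2D≤n K≤D
  ... | inj₂ D≤K = bound-small-D A O c solves K′ (≤-trans (m≤n+m _ _) large) 2D≤n (s≤s (s≤s z≤n)) D≤K
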